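{- Let $\sigma$ and $\pi$ be permutations, and let $m_1=(\sigma,R_1)$ and $m_2=(\sigma,R_2)$ be mesh patterns with the same underlying classical pattern $\sigma$. Regard $\pi=(\pi,\emptyset)$ as a (dominating) classical pattern and assume $|\pi|\le|\sigma|+1$. Suppose there is a box $(a,b)\in[0,|\sigma|]\times[0,|\sigma|]$ such that 1. $R_2=R_1\cup\{(a,b)\}$, and 2. $\pi\preceq\sigma^{(a,b)}$. Then $m_1$ and $m_2$ are coincident under $\pi$, i.e. $\mathrm{Av}(\{\pi,m_1\})=\mathrm{Av}(\{\pi,m_2\})$.
   Context: Write $[n]=\{1,\dots,n\}$ and $[0,k]=\{0,1,\dots,k\}$. A permutation of length $n$ is a bijection of $[n]$, written in one-line notation; $|\sigma|$ is the length of $\sigma$ and $G(\sigma)=\{(i,\sigma(i)) : i\in[n]\}$ is its plot. For permutations, $\sigma\preceq\pi$ means that $\pi$ contains $\sigma$ as a classical pattern, i.e. some subsequence of $\pi$ is order isomorphic to $\sigma$. A mesh pattern of length $k$ is a pair $p=(\tau,R)$ with $\tau$ a permutation of length $k$ (the underlying classical pattern) and $R\subseteq[0,k]\times[0,k]$; the element $(i,j)$ of $[0,k]\times[0,k]$ denotes the unit box with lower left corner $(i,j)$. An occurrence of $p$ in a permutation $\pi$ of length $n$ is a subset $\omega\subseteq G(\pi)$ for which there are order-preserving injections $\alpha,\beta:[k]\to[n]$ such that (i) $\omega=\{(\alpha(i),\beta(j)):(i,j)\in G(\tau)\}$, and (ii) with $\alpha(0)=\beta(0)=0$, $\alpha(k+1)=\beta(k+1)=n+1$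 and $R_{ij}=[\alpha(i)+1,\alpha(i+1)-1]\times[\beta(j)+1,\beta(j+1)-1]$ (the region corresponding to the box $(i,j)$), one has $R_{ij}\cap G(\pi)=\emptyset$ for every $(i,j)\in R$. A permutation contains $p$ if it has an occurrence of $p$, and avoids $p$ otherwise. A classical pattern $\pi$ is identified with the mesh pattern $(\pi,\emptyset)$. $\mathrm{Av}(S)$ is the set of all permutations (of all lengths) avoiding every pattern in $S$. Two mesh patterns $p_1,p_2$ are coincident under $\pi$ if $\mathrm{Av}(\{\pi,p_1\})=\mathrm{Av}(\{\pi,p_2\})$. For a permutation $\sigma$ of length $n$ and a box $(a,b)\in[0,n]^2$, $\sigma^{(a,b)}$ is the permutation of length $n+1$ obtained by inserting a point in the box $(a,b)$ of the plot of $\sigma$: $\sigma^{(a,b)}(a+1)=b+1$; for $k\le a$, $\sigma^{(a,b)}(k)=\sigma(k)$ if $\sigma(k)\le b$ and $\sigma(k)+1$ otherwise; for $k>a+1$, $\sigma^{(a,b)}(k)=\sigma(k-1)$ if $\sigma(k-1)\le b$ and $\sigma(k-1)+1$ otherwise. -}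

module Defs where

open import Data.Fin using (Fin; zero; suc; toℕ; inject₁; _≤_; _<_)
open import Data.Fin.Permutation using (Permutation′; _⟨$⟩ʳ_; insert)
open import Data.Fin.Relation.Unary.Top using (view; ‵fromℕ; ‵inject₁)
open import Data.Nat as ℕ using (ℕ)
open import Data.Product using (Σ-syntax; ∃-syntax; _×_; _,_)
open import Function.Bundles using (_⇔_)
open import Function.Definitions using (Injective)
open import Level using (0ℓ) renaming (suc to lsuc)
open import Relation.Binary.Core using (_Preserves_⟶_)
open import Relation.Binary.PropositionalEquality using (_≡_)
open import Relation.Nullary using (¬_)
open import Relation.Unary using (Pred; _∈_; _⊆_; _≐_; _∪_; _∩_; ∅; ｛_｝; Empty)

-- Permutations of all lengths.  Positions and values are 0-based: the element
-- i of [n] is represented by the element of Fin n whose toℕ is i − 1.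
record Perm : Set where
  constructor perm
  field
    {size}    : ℕ
    bijection : Permutation′ size

  at : Fin size → Fin size
  at i = bijection ⟨$⟩ʳ i

open Perm public using (size; bijection; at)

∣_∣ : Perm → ℕ
∣ π ∣ = size π

Plot : (π : Perm) → Pred (Fin ∣ π ∣ × Fin ∣ π ∣) 0ℓ
Plot π (i , j) = at π i ≡ j

OrderPreservingInjection : ∀ {k n} → (Fin k → Fin n) → Set
OrderPreservingInjection α = α Preserves _≤_ ⟶ _≤_ × Injective _≡_ _≡_ α

OrderIsomorphic : ∀ {k m n} → (Fin k → Fin m) → (Fin k → Fin n) → Set
OrderIsomorphic u v = ∀ i j → (u i < u j) ⇔ (v i < v j)

infix 4 _⪯_

-- The map ι selects the positions of the subsequence.
_⪯_ : Perm → Perm → Set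
σ ⪯ π = Σ[ ι ∈ (Fin ∣ σ ∣ → Fin ∣ π ∣) ]
  OrderPreservingInjection ι × OrderIsomorphic (at σ) (λ i → at π (ι i))

-- Boxes, unlike points, need no shift: (i , j) is the unit box whose lower left
-- corner is (toℕ i , toℕ j).
Box : ℕ → Set
Box k = Fin (ℕ.suc k) × Fin (ℕ.suc k)

record MeshPattern : Set₁ where
  constructor mesh
  field
    underlying : Perm
    shading    : Pred (Box ∣ underlying ∣) 0ℓ

open MeshPattern public

classical : Perm → MeshPattern
classical π = mesh π ∅

-- The 1-based coordinate of a position or value.
coord : ∀ {n} → Fin n → ℕ
coord x = ℕ.suc (toℕ x)

-- The extension of α : [k] → [n] by α(0) = 0 and α(k+1) = n+1, in 1-based
-- coordinates.  In the second clause the argument is i+1 with 0 ≤ i ≤ k; view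
-- tells whether i = k (fromℕ) or i < k (inject₁).
extend : ∀ {k n} → (Fin k → Fin n) → Fin (ℕ.suc (ℕ.suc k)) → ℕ
extend α zero = 0
extend {n = n} α (suc i) with view i
... | ‵fromℕ     = ℕ.suc n
... | ‵inject₁ j = coord (α j)

-- The integers x with α(i) + 1 ≤ x ≤ α(i+1) − 1.
Strip : ∀ {k n} → (Fin k → Fin n) → Fin (ℕ.suc k) → Pred (Fin n) 0ℓ
Strip α i x = extend α (inject₁ i) ℕ.< coord x × coord x ℕ.< extend α (suc i)

Region : ∀ {k n} → (α β : Fin k → Fin n) → Box k → Pred (Fin n × Fin n) 0ℓ
Region α β (i , j) (x , y) = x ∈ Strip α i × y ∈ Strip β j

Image : ∀ {k n} → (α β : Fin k → Fin n) →
        Pred (Fin k × Fin k) 0ℓ → Pred (Fin n × Fin n) 0ℓ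
Image α β S (x , y) = ∃[ i ] ∃[ j ] ((i , j) ∈ S × (x , y) ≡ (α i , β j))

IsOccurrence : (p : MeshPattern) (π : Perm) → Pred (Fin ∣ π ∣ × Fin ∣ π ∣) 0ℓ → Set
IsOccurrence (mesh τ R) π ω =
  ω ⊆ Plot π ×
  Σ[ α ∈ (Fin ∣ τ ∣ → Fin ∣ π ∣) ] Σ[ β ∈ (Fin ∣ τ ∣ → Fin ∣ π ∣) ]
    OrderPreservingInjection α ×
    OrderPreservingInjection β ×
    ω ≐ Image α β (Plot τ) ×
    (∀ box → box ∈ R → Empty (Region α β box ∩ Plot π))

Contains : Perm → MeshPattern → Set₁
Contains π p = ∃[ ω ] IsOccurrence p π ω

Avoids : Perm → MeshPattern → Set₁
Avoids π p = ¬ Contains π p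

Av : Pred MeshPattern (lsuc 0ℓ) → Pred Perm (lsuc 0ℓ)
Av S π = ∀ p → p ∈ S → Avoids π p

CoincidentUnder : Perm → MeshPattern → MeshPattern → Set₁
CoincidentUnder π p₁ p₂ =
  Av (｛ classical π ｝ ∪ ｛ p₁ ｝) ≐ Av (｛ classical π ｝ ∪ ｛ p₂ ｝)

infix 8 _^⟨_⟩

-- σ^(a,b).  The library's insert a b sends the 0-based position a to the 0-based
-- value b, and moves the other positions and values up past a and b by punchIn.
_^⟨_⟩ : (σ : Perm) → Box ∣ σ ∣ → Perm
σ ^⟨ a , b ⟩ = perm (insert a b (bijection σ))

{-# OPTIONS --safe #-}

-- If the occurrence of (σ , R₁) given by α, β had a point (x , y) of τ in the
-- region of the box (a , b), then inserting x into α at a and y into β at b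
-- would exhibit σ^(a,b), and hence π, as a classical pattern of τ. So in a
-- permutation avoiding π the box (a , b) is empty for every occurrence of
-- (σ , R₁), and may be shaded at will.
module Submission where

open import Defs
open import Data.Nat using (_≤_; _+_)
open import Data.Product using (Σ-syntax; _×_)
open import Level using (0ℓ)
open import Relation.Unary using (Pred; _≐_; _∪_; ｛_｝)

open import Data.Fin as Fin using (Fin; zero; suc; toℕ; inject₁; punchIn)
open import Data.Fin.Permutation
  using (Permutation′; _⟨$⟩ʳ_; _⟨$⟩ˡ_; insert; insert-punchIn; inverseˡ; inverseʳ)
open import Data.Fin.Properties
  using (<-cmp; <-irrefl; ≤∧≢⇒<; toℕ<n; toℕ-fromℕ; toℕ-inject₁; punchIn-punchOut; punchIn-mono-≤)
open import Data.Fin.Relation.Unary.Top using (view; ‵fromℕ; ‵inject₁; view-inject₁)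
import Data.Nat as ℕ
import Data.Nat.Properties as ℕ
open import Data.Product using (_,_; proj₁; proj₂)
open import Data.Sum using (inj₁; inj₂)
open import Data.Vec.Functional using (insertAt)
open import Data.Vec.Functional.Properties using (insertAt-lookup; insertAt-punchIn)
open import Function using (_∘_; Equivalence)
open import Relation.Binary using (_Preserves_⟶_; tri<; tri≈; tri>)
open import Relation.Binary.PropositionalEquality
open import Relation.Nullary using (yes; no; contradiction)
open import Relation.Unary using (_∈_; _∩_; Empty)

-- On the linear order of `Fin` this is equivalent to `OrderPreservingInjection`, but it is a single
-- condition, easier to check by cases and to compose.
StrictlyMonotone : ∀ {k n} → (Fin k → Fin n) → Set
StrictlyMonotone α = α Preserves Fin._<_ ⟶ Fin._<_

opi⇒strictlyMonotone : ∀ {k n} {α : Fin k → Fin n} →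
  OrderPreservingInjection α → StrictlyMonotone α
opi⇒strictlyMonotone (mono , inj) i<j =
  ≤∧≢⇒< (mono (ℕ.<⇒≤ i<j)) (λ αi≡αj → <-irrefl (inj αi≡αj) i<j)

strictlyMonotone⇒opi : ∀ {k n} {α : Fin k → Fin n} →
  StrictlyMonotone α → OrderPreservingInjection α
strictlyMonotone⇒opi {α = α} α-mono = mono , inj
  where
  mono : α Preserves Fin._≤_ ⟶ Fin._≤_
  mono {i} {j} i≤j with <-cmp i j
  ... | tri< i<j _ _  = ℕ.<⇒≤ (α-mono i<j)
  ... | tri≈ _ refl _ = ℕ.≤-refl
  ... | tri> _ _ j<i  = contradiction i≤j (ℕ.<⇒≱ j<i)

  inj : ∀ {i j} → α i ≡ α j → i ≡ j
  inj {i} {j} αi≡αj with <-cmp i j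
  ... | tri< i<j _ _ = contradiction (α-mono i<j) (<-irrefl αi≡αj)
  ... | tri≈ _ i≡j _ = i≡j
  ... | tri> _ _ j<i = contradiction (α-mono j<i) (<-irrefl (sym αi≡αj))

data PunchInView {n} (i : Fin (ℕ.suc n)) : Fin (ℕ.suc n) → Set where
  hole    : PunchInView i i
  punched : ∀ j → PunchInView i (punchIn i j)

punchInView : ∀ {n} (i j : Fin (ℕ.suc n)) → PunchInView i j
punchInView i j with i Fin.≟ j
... | yes refl = hole
... | no  i≢j  = subst (PunchInView i) (punchIn-punchOut i≢j) (punched _)

punchIn<⇒< : ∀ {n} (i : Fin (ℕ.suc n)) (j : Fin n) → punchIn i j Fin.< i → j Fin.< i
punchIn<⇒< (suc i) zero    _         = ℕ.z<s
punchIn<⇒< (suc i) (suc j) (ℕ.s≤s p) = ℕ.s<s (punchIn<⇒< i j p)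

-- Indices from `i` on are moved up by one, so undoing the shift turns the strict bound into a weak
-- one.
<punchIn⇒≤ : ∀ {n} (i : Fin (ℕ.suc n)) (j : Fin n) → i Fin.< punchIn i j → i Fin.≤ j
<punchIn⇒≤ zero    _       _         = ℕ.z≤n
<punchIn⇒≤ (suc i) (suc j) (ℕ.s≤s p) = ℕ.s≤s (<punchIn⇒≤ i j p)

punchIn-cancel-< : ∀ {n} (i : Fin (ℕ.suc n)) (j k : Fin n) →
  punchIn i j Fin.< punchIn i k → j Fin.< k
punchIn-cancel-< i j k p = ℕ.≰⇒> (ℕ.<⇒≱ p ∘ punchIn-mono-≤ i k j)

-- The left border of strip `a` is the coordinate of the last value of `α` before the box, which
-- bounds all the earlier ones.
coord≤extend : ∀ {k n} {α : Fin k → Fin n} → α Preserves Fin._≤_ ⟶ Fin._≤_ →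
  ∀ i (a : Fin (ℕ.suc k)) → i Fin.< a → coord (α i) ≤ extend α (inject₁ a)
coord≤extend mono i (suc a) (ℕ.s≤s i≤a) rewrite view-inject₁ a = ℕ.s≤s (mono i≤a)

extend≤coord : ∀ {k n} {α : Fin k → Fin n} → α Preserves Fin._≤_ ⟶ Fin._≤_ →
  ∀ i (a : Fin (ℕ.suc k)) → a Fin.≤ i → extend α (suc a) ≤ coord (α i)
extend≤coord mono i a a≤i with view a
-- The border n+1 belongs only to the last strip, which has no position of the pattern to its right.
... | ‵fromℕ {n}  = contradiction a≤i (ℕ.<⇒≱ (subst (toℕ i ℕ.<_) (sym (toℕ-fromℕ n)) (toℕ<n i)))
... | ‵inject₁ j = ℕ.s≤s (mono (subst (_≤ toℕ i) (toℕ-inject₁ j) a≤i))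

-- The borders of the strip separate the values of `α` before `a` from those after it, and `x` lies
-- strictly between the borders.
insertAt-strictlyMonotone : ∀ {k n} {α : Fin k → Fin n} {a x} →
  OrderPreservingInjection α → x ∈ Strip α a → StrictlyMonotone (insertAt α a x)
insertAt-strictlyMonotone {α = α} {a} {x} α-opi (lo , hi) {i} {j} i<j
  with punchInView a i | punchInView a j
... | hole | hole = contradiction i<j (<-irrefl refl)
... | hole | punched j′
  rewrite insertAt-lookup α a x | insertAt-punchIn α a x j′ =
  -- `ℕ.s<s⁻¹` passes from 1-based coordinates back to the order of `Fin`.
  ℕ.s<s⁻¹ (ℕ.<-≤-trans hi (extend≤coord (proj₁ α-opi) j′ a (<punchIn⇒≤ a j′ i<j)))
... | punched i′ | hole
  rewrite insertAt-lookup α a x | insertAt-punchIn α a x i′ =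
  ℕ.s<s⁻¹ (ℕ.≤-<-trans (coord≤extend (proj₁ α-opi) i′ a (punchIn<⇒< a i′ i<j)) lo)
... | punched i′ | punched j′
  rewrite insertAt-punchIn α a x i′ | insertAt-punchIn α a x j′ =
  opi⇒strictlyMonotone α-opi (punchIn-cancel-< a i′ j′ i<j)

insert-lookup : ∀ {n} i j (ρ : Permutation′ n) → insert i j ρ ⟨$⟩ʳ i ≡ j
insert-lookup i j ρ with i Fin.≟ i
... | yes _  = refl
... | no i≢i = contradiction refl i≢i

-- At the hole `insert` sends `a` to `b`, which leaves the new point; elsewhere all three insertions
-- commute with `punchIn`, which leaves the old points.
insertAt-plot : ∀ (σ τ : Perm) {α β : Fin ∣ σ ∣ → Fin ∣ τ ∣} {a b x y} →
  (∀ i → at τ (α i) ≡ β (at σ i)) → at τ x ≡ y →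
  ∀ i → at τ (insertAt α a x i) ≡ insertAt β b y (at (σ ^⟨ a , b ⟩) i)
insertAt-plot σ τ {α} {β} {a} {b} {x} {y} τα≡βσ τx≡y i with punchInView a i
... | hole
  rewrite insertAt-lookup α a x | insert-lookup a b (bijection σ) | insertAt-lookup β b y = τx≡y
... | punched i′
  rewrite insertAt-punchIn α a x i′ | insert-punchIn a b (bijection σ) i′
        | insertAt-punchIn β b y (at σ i′) = τα≡βσ i′

contains-classical : ∀ (π ρ τ : Perm) {α β : Fin ∣ ρ ∣ → Fin ∣ τ ∣} →
  StrictlyMonotone α → StrictlyMonotone β → (∀ i → at τ (α i) ≡ β (at ρ i)) →
  π ⪯ ρ → Contains τ (classical π)
contains-classical π ρ τ {α} {β} α-mono β-mono τα≡βρ (ι , ι-opi , iso) =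
  Image α′ β′ (Plot π) ,
  (λ { (i , _ , refl , refl) → plot i }) ,
  α′ , β′ ,
  strictlyMonotone⇒opi (α-mono ∘ opi⇒strictlyMonotone ι-opi) ,
  strictlyMonotone⇒opi β′-mono ,
  ((λ p → p) , (λ p → p)) ,
  λ _ ()
  where
  α′ β′ : Fin ∣ π ∣ → Fin ∣ τ ∣
  α′ i = α (ι i)
  -- `_⪯_` supplies positions only, so a value of `π` is traced back to its position, and the value
  -- found at the selected place is read off.
  β′ v = β (at ρ (ι (bijection π ⟨$⟩ˡ v)))

  plot : ∀ i → at τ (α′ i) ≡ β′ (at π i)
  plot i = trans (τα≡βρ (ι i)) (cong (λ j → β (at ρ (ι j))) (sym (inverseˡ (bijection π))))

  β′-mono : StrictlyMonotone β′
  -- Writing `v` and `w` as values of `π` at their preimages lets the order isomorphism apply.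
  β′-mono {v} {w} v<w = β-mono (Equivalence.to (iso _ _)
    (subst₂ Fin._<_ (sym (inverseʳ (bijection π) {v})) (sym (inverseʳ (bijection π) {w})) v<w))

occurrence-box-empty : ∀ (σ π τ : Perm) {α β : Fin ∣ σ ∣ → Fin ∣ τ ∣} (box : Box ∣ σ ∣) →
  OrderPreservingInjection α → OrderPreservingInjection β →
  (∀ i → at τ (α i) ≡ β (at σ i)) → π ⪯ σ ^⟨ box ⟩ → Avoids τ (classical π) →
  Empty (Region α β box ∩ Plot τ)
occurrence-box-empty σ π τ {β = β} box α-opi β-opi τα≡βσ π⪯σ⁺ avoids (x , y) ((x∈ , y∈) , τx≡y) =
  avoids (contains-classical π (σ ^⟨ box ⟩) τ
    (insertAt-strictlyMonotone α-opi x∈) (insertAt-strictlyMonotone β-opi y∈)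
    (insertAt-plot σ τ {β = β} {a = proj₁ box} {b = proj₂ box} τα≡βσ τx≡y) π⪯σ⁺)

proposition3p5 : (σ π : Perm) (R₁ R₂ : Pred (Box ∣ σ ∣) 0ℓ) →
    ∣ π ∣ ≤ ∣ σ ∣ + 1 →
    (Σ[ box ∈ Box ∣ σ ∣ ] (R₂ ≐ (R₁ ∪ ｛ box ｝) × π ⪯ σ ^⟨ box ⟩)) →
    CoincidentUnder π (mesh σ R₁) (mesh σ R₂)
proposition3p5 σ π R₁ R₂ _ (box , (R₂⊆ , ⊆R₂) , π⪯σ⁺) =
  (λ {τ} → fewer⇒more {τ}) , (λ {τ} → more⇒fewer {τ})
  where
  fewer⇒more : ∀ {τ} → Av (｛ classical π ｝ ∪ ｛ mesh σ R₁ ｝) τ →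
                       Av (｛ classical π ｝ ∪ ｛ mesh σ R₂ ｝) τ
  fewer⇒more av _ (inj₁ p) = av _ (inj₁ p)
  -- An occurrence of `mesh σ R₂` is also one of `mesh σ R₁`, as fewer boxes have to be empty.
  fewer⇒more av _ (inj₂ refl) (ω , ω⊆ , α , β , α-opi , β-opi , ω≐ , empty) =
    av _ (inj₂ refl)
      (ω , ω⊆ , α , β , α-opi , β-opi , ω≐ , λ c c∈R₁ → empty c (⊆R₂ (inj₁ c∈R₁)))

  more⇒fewer : ∀ {τ} → Av (｛ classical π ｝ ∪ ｛ mesh σ R₂ ｝) τ →
                       Av (｛ classical π ｝ ∪ ｛ mesh σ R₁ ｝) τ
  more⇒fewer av _ (inj₁ p) = av _ (inj₁ p)
  more⇒fewer {τ} av _ (inj₂ refl) (ω , ω⊆ , α , β , α-opi , β-opi , ω≐ , empty) =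
    av _ (inj₂ refl) (ω , ω⊆ , α , β , α-opi , β-opi , ω≐ , empty′)
    where
    empty′ : ∀ c → c ∈ R₂ → Empty (Region α β c ∩ Plot τ)
    empty′ c c∈R₂ with R₂⊆ c∈R₂
    ... | inj₁ c∈R₁ = empty c c∈R₁
    -- For the added box, each point (α i, β (σ i)) lies in the image, hence in `ω` and in the plot
    -- of `τ`.
    ... | inj₂ refl = occurrence-box-empty σ π τ box α-opi β-opi
      (λ i → ω⊆ (proj₂ ω≐ (i , at σ i , refl , refl))) π⪯σ⁺ (av _ (inj₁ refl))
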